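{- Let $n\ge 1$ and let $p,k,q$ be integers with $p\ge n-1$, $k\ge 0$, $q\ge 0$ and $\binom{n}{2}=k\cdot p+q$. Then $K_n$ has a Gallai $(k+1)$-coloring in which $k$ of the color classes have exactly $p$ edges each and the remaining color class has exactly $q$ edges.
   Context: A Gallai $m$-coloring of the complete graph $K_n$ is an assignment of one of the colors $1,\dots,m$ to each edge of $K_n$ (adjacent edges may have the same color, and a color class is allowed to be empty) such that no triangle has its three edges colored with three pairwise different colors. A color class is the set of all edges of a given color. -}

module Defs where

open import Data.Nat.Base using (ℕ)
open import Data.Fin.Base using (Fin; _<_)
open import Data.Fin.Properties using (<-trans)
open import Data.Product.Base using (Σ; _×_)
open import Function.Bundles using (_↔_)
open import Relation.Binary.PropositionalEquality.Core using (_≡_; _≢_)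
open import Relation.Nullary.Negation.Core using (¬_)

-- An unordered pair of distinct vertices is represented by its increasing
-- listing; the order proof is irrelevant, so an edge is determined by its
-- endpoints.
record Edge (n : ℕ) : Set where
  constructor edge
  field
    lo hi  : Fin n
    .lo<hi : lo < hi

EdgeColoring : ℕ → ℕ → Set
EdgeColoring n m = Edge n → Fin m

-- Every triangle has a unique increasing listing u < v < w of its vertices.
Rainbow : ∀ {n m} → EdgeColoring n m → (u v w : Fin n) → u < v → v < w → Set
Rainbow χ u v w u<v v<w = uv ≢ vw × vw ≢ uw × uv ≢ uw
  where
  uv = χ (edge u v u<v)
  vw = χ (edge v w v<w)
  uw = χ (edge u w (<-trans u<v v<w))

IsGallai : ∀ {n m} → EdgeColoring n m → Set
IsGallai {n} χ =
  ∀ (u v w : Fin n) (u<v : u < v) (v<w : v < w) → ¬ Rainbow χ u v w u<v v<w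

ColorClass : ∀ {n m} → EdgeColoring n m → Fin m → Set
ColorClass {n} χ c = Σ (Edge n) λ e → χ e ≡ c

HasExactly : Set → ℕ → Set
HasExactly A s = A ↔ Fin s

{-# OPTIONS --safe #-}

-- Colour every edge by a function of its larger endpoint: then each triangle
-- has two edges of the same colour.  Vertex i (counted from 0) is the larger
-- endpoint of i edges, so it suffices to find k disjoint subsets of
-- {0, …, n − 1} with sum p each; the rest automatically has sum q.
--
-- For such subsets, argue by induction on n, assuming only n ≤ p + 1 and
-- k p ≤ n (n − 1) / 2.  If p < 2n − 1, pair i with p − i for all
-- i ≥ n′ = p + 1 − n.  What remains is {0, …, n′ − 1} and, when p is even,
-- p / 2; in the latter case take subsets of sum p / 2 from {0, …, n′ − 1}, put
-- one of them together with the element p / 2, and join the others two by two.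
-- If p ≥ 2n − 1, the 2k largest elements form k pairs of equal sum, one for
-- each subset, and the induction hypothesis fills up the subsets.
module Submission where

open import Defs
open import Data.Nat.Base using (ℕ; zero; suc; _+_; _*_; _∸_; _⊓_; _≤_; _≥_; _<_; z≤n; s≤s; ⌈_/2⌉)
open import Data.Nat.Properties
open import Data.Nat.Combinatorics using (_C_; nC1≡n; nCk+nC[k+1]≡[n+1]C[k+1])
open import Data.Nat.Induction using (<-wellFounded)
open import Data.Nat.Tactic.RingSolver using (solve-∀)
open import Data.Fin.Base using (Fin; zero; suc; toℕ; fromℕ; fromℕ<; inject)
open import Data.Fin.Properties
  using (+↔⊎; toℕ<n; toℕ-injective; toℕ-inject; toℕ-fromℕ; toℕ-fromℕ<)
  renaming (_≟_ to _≟F_)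
open import Data.List.Base
  using (List; []; _∷_; _++_; map; length; lookup; replicate; applyUpTo; upTo; downFrom)
open import Data.List.Properties
  using (length-++; length-map; length-replicate; length-upTo; length-downFrom; map-upTo)
open import Data.Empty using (⊥-elim)
open import Data.Product.Base using (Σ; ∃; _×_; _,_; proj₂)
open import Data.Sum.Base using (_⊎_; inj₁; inj₂)
open import Data.Sum.Function.Propositional using (_⊎-↔_)
open import Function.Base using (_∘_)
open import Function.Bundles using (_↔_; mk↔ₛ′)
open import Function.Construct.Composition using (_↔-∘_)
open import Function.Construct.Symmetry using (↔-sym)
open import Induction.WellFounded using (Acc; acc)
open import Relation.Binary.PropositionalEquality
  using (_≡_; _≢_; refl; sym; trans; cong; cong₂; subst; subst₂; module ≡-Reasoning)
open import Relation.Nullary.Decidable.Core using (yes; no)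
open import Relation.Nullary.Negation.Core using (contradiction)

-- The Kronecker delta under shifting, halving and truncating colours

δ : ℕ → ℕ → ℕ
δ zero    zero    = 1
δ zero    (suc x) = 0
δ (suc c) zero    = 0
δ (suc c) (suc x) = δ c x

δ-refl : ∀ c → δ c c ≡ 1
δ-refl zero    = refl
δ-refl (suc c) = δ-refl c

δ-≢ : ∀ c x → c ≢ x → δ c x ≡ 0
δ-≢ zero    zero    c≢x = contradiction refl c≢x
δ-≢ zero    (suc x) c≢x = refl
δ-≢ (suc c) zero    c≢x = refl
δ-≢ (suc c) (suc x) c≢x = δ-≢ c x (c≢x ∘ cong suc)

δ-+ : ∀ j c x → δ (j + c) (j + x) ≡ δ c x
δ-+ zero    c x = refl
δ-+ (suc j) c x = δ-+ j c x

δ-< : ∀ {j c} x → c < j → δ c (j + x) ≡ 0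
δ-< {j} {c} x c<j = δ-≢ c (j + x) (<⇒≢ (<-≤-trans c<j (m≤m+n j x)))

δ-zero-⌈/2⌉ : ∀ x → δ 0 ⌈ x /2⌉ ≡ δ 0 x
δ-zero-⌈/2⌉ zero          = refl
δ-zero-⌈/2⌉ (suc zero)    = refl
δ-zero-⌈/2⌉ (suc (suc x)) = refl

-- Rounding up collapses 2t + 1 and 2t + 2, so halving merges the positive colours two by two and
-- keeps 0 alone.
δ-suc-⌈/2⌉ : ∀ t x → δ (suc t) ⌈ x /2⌉ ≡ δ (1 + (t + t)) x + δ (2 + (t + t)) x
δ-suc-⌈/2⌉ zero    zero             = refl
δ-suc-⌈/2⌉ zero    (suc zero)       = refl
δ-suc-⌈/2⌉ zero    (suc (suc x))    = δ-zero-⌈/2⌉ x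
δ-suc-⌈/2⌉ (suc t) zero             = refl
δ-suc-⌈/2⌉ (suc t) (suc zero)       = refl
δ-suc-⌈/2⌉ (suc t) (suc (suc x)) rewrite +-suc t t = δ-suc-⌈/2⌉ t x

δ-⊓ : ∀ {c k} x → c < k → δ c (x ⊓ k) ≡ δ c x
δ-⊓ {zero}  {suc k} zero    c<k       = refl
δ-⊓ {zero}  {suc k} (suc x) c<k       = refl
δ-⊓ {suc c} {suc k} zero    c<k       = refl
δ-⊓ {suc c} {suc k} (suc x) (s≤s c<k) = δ-⊓ x c<k

-- δ k (x ⊓ k) is the indicator of k ≤ x.
δ-⊓-suc : ∀ k x → δ k (x ⊓ k) ≡ δ k x + δ (suc k) (x ⊓ suc k)
δ-⊓-suc zero    zero          = refl
δ-⊓-suc zero    (suc zero)    = refl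
δ-⊓-suc zero    (suc (suc x)) = refl
δ-⊓-suc (suc k) zero          = refl
δ-⊓-suc (suc k) (suc x)       = δ-⊓-suc k x

-- Sums of the integers of a given colour

-- A list is read as a colouring of the consecutive integers o, o + 1, …
moment : ∀ {A : Set} → ℕ → (A → ℕ) → List A → ℕ
moment o g []       = 0
moment o g (x ∷ xs) = g x * o + moment (suc o) g xs

moment-cong : ∀ {A : Set} o {g h : A → ℕ} xs → (∀ x → g x ≡ h x) → moment o g xs ≡ moment o h xs
moment-cong o []       eq = refl
moment-cong o (x ∷ xs) eq = cong₂ _+_ (cong (_* o) (eq x)) (moment-cong (suc o) xs eq)

moment-zero : ∀ {A : Set} o {g : A → ℕ} xs → (∀ x → g x ≡ 0) → moment o g xs ≡ 0
moment-zero o []       eq = refl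
moment-zero o (x ∷ xs) eq rewrite eq x = moment-zero (suc o) xs eq

moment-map : ∀ {A B : Set} o (g : B → ℕ) (f : A → B) xs → moment o g (map f xs) ≡ moment o (g ∘ f) xs
moment-map o g f []       = refl
moment-map o g f (x ∷ xs) = cong (g (f x) * o +_) (moment-map (suc o) g f xs)

moment-+ : ∀ {A : Set} o (g h : A → ℕ) xs →
  moment o (λ x → g x + h x) xs ≡ moment o g xs + moment o h xs
moment-+ o g h []       = refl
moment-+ o g h (x ∷ xs) rewrite moment-+ (suc o) g h xs =
  rearrange (g x) (h x) o (moment (suc o) g xs) (moment (suc o) h xs)
  where
  rearrange : ∀ a b o m n → (a + b) * o + (m + n) ≡ (a * o + m) + (b * o + n)
  rearrange = solve-∀

moment-++ : ∀ {A : Set} o (g : A → ℕ) xs ys →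
  moment o g (xs ++ ys) ≡ moment o g xs + moment (o + length xs) g ys
moment-++ o g []       ys rewrite +-identityʳ o = refl
moment-++ o g (x ∷ xs) ys rewrite moment-++ (suc o) g xs ys | +-suc o (length xs) =
  sym (+-assoc (g x * o) _ _)

moment-replicate : ∀ {A : Set} o (g : A → ℕ) n x → g x ≡ 0 → moment o g (replicate n x) ≡ 0
moment-replicate o g zero    x gx≡0 = refl
moment-replicate o g (suc n) x gx≡0 rewrite gx≡0 = moment-replicate (suc o) g n x gx≡0

moment-const-1 : ∀ {A : Set} o (xs : List A) →
  moment o (λ _ → 1) xs ≡ length xs * o + length xs C 2
moment-const-1 o []       = refl
moment-const-1 o (x ∷ xs) = begin
  1 * o + moment (suc o) (λ _ → 1) xs  ≡⟨ cong (1 * o +_) (moment-const-1 (suc o) xs) ⟩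
  1 * o + (l * suc o + l C 2)          ≡⟨ rearrange o l (l C 2) ⟩
  suc l * o + (l + l C 2)              ≡⟨ cong (λ m → suc l * o + (m + l C 2)) (sym (nC1≡n l)) ⟩
  suc l * o + (l C 1 + l C 2)          ≡⟨ cong (suc l * o +_) (nCk+nC[k+1]≡[n+1]C[k+1] l 1) ⟩
  suc l * o + suc l C 2                ∎
  where
  open ≡-Reasoning
  l = length xs
  rearrange : ∀ o l t → 1 * o + (l * suc o + t) ≡ suc l * o + (l + t)
  rearrange = solve-∀

-- Truncation at `k` gathers all colours from `k` on, and lowering `k` by one adds a single colour
-- to that class. So it receives exactly what the first `k` colours leave of the total.
moment-δ-⊓ : ∀ o {p} k xs → (∀ {c} → c < k → moment o (δ c) xs ≡ p) →
  k * p + moment o (λ x → δ k (x ⊓ k)) xs ≡ moment o (λ _ → 1) xs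
moment-δ-⊓ o     zero    xs eq = moment-cong o xs λ x → cong (δ 0) (⊓-zeroʳ x)
moment-δ-⊓ o {p} (suc k) xs eq = begin
  (p + k * p) + tail (suc k)                   ≡⟨ cong (_+ tail (suc k)) (+-comm p (k * p)) ⟩
  (k * p + p) + tail (suc k)                   ≡⟨ +-assoc (k * p) p _ ⟩
  k * p + (p + tail (suc k))                   ≡⟨ cong (λ m → k * p + (m + tail (suc k))) (sym (eq ≤-refl)) ⟩
  k * p + (moment o (δ k) xs + tail (suc k))   ≡⟨ cong (k * p +_) (sym (moment-+ o (δ k) _ xs)) ⟩
  k * p + moment o (λ x → δ k x + δ (suc k) (x ⊓ suc k)) xs
    ≡⟨ cong (k * p +_) (sym (moment-cong o xs (δ-⊓-suc k))) ⟩
  k * p + tail k                               ≡⟨ moment-δ-⊓ o k xs (eq ∘ m<n⇒m<1+n) ⟩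
  moment o (λ _ → 1) xs                        ∎
  where
  open ≡-Reasoning
  tail : ℕ → ℕ
  tail k = moment o (λ x → δ k (x ⊓ k)) xs

-- Runs of colours and pairs of equal sum

moment-applyUpTo-suc : ∀ o (g : ℕ → ℕ) j → moment o g (applyUpTo suc j) ≡ moment o (g ∘ suc) (upTo j)
moment-applyUpTo-suc o g j = trans (cong (moment o g) (sym (map-upTo suc j))) (moment-map o g suc (upTo j))

moment-upTo : ∀ o {c j} → c < j → moment o (δ c) (upTo j) ≡ o + c
moment-upTo o {zero}  {suc j} _ = cong₂ _+_ (+-identityʳ o)
  (trans (moment-applyUpTo-suc (suc o) (δ 0) j) (moment-zero (suc o) (upTo j) λ _ → refl))
moment-upTo o {suc c} {suc j} (s≤s c<j) = trans (moment-applyUpTo-suc (suc o) (δ (suc c)) j)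
  (trans (moment-upTo (suc o) c<j) (sym (+-suc o c)))

moment-upTo-≥ : ∀ o {c j} → j ≤ c → moment o (δ c) (upTo j) ≡ 0
moment-upTo-≥ o {c}     {zero}  _ = refl
moment-upTo-≥ o {suc c} {suc j} (s≤s j≤c) =
  trans (moment-applyUpTo-suc (suc o) (δ (suc c)) j) (moment-upTo-≥ (suc o) j≤c)

moment-downFrom-≥ : ∀ o {c j} → j ≤ c → moment o (δ c) (downFrom j) ≡ 0
moment-downFrom-≥ o {c} {zero}  _   = refl
moment-downFrom-≥ o {c} {suc j} j<c rewrite δ-≢ c j (<⇒≢ j<c ∘ sym) =
  moment-downFrom-≥ (suc o) (<⇒≤ j<c)

moment-downFrom : ∀ o {c j} → c < j → suc c + moment o (δ c) (downFrom j) ≡ o + j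
moment-downFrom o {c} {suc j} (s≤s c≤j) with c ≟ j
... | yes refl rewrite δ-refl c | moment-downFrom-≥ (suc o) {c} {c} ≤-refl = rearrange c o
  where
  rearrange : ∀ c o → suc (c + (o + 0 + 0)) ≡ o + suc c
  rearrange = solve-∀
... | no c≢j rewrite δ-≢ c j c≢j =
  trans (moment-downFrom (suc o) (≤∧≢⇒< c≤j c≢j)) (sym (+-suc o j))

-- The colours rise from 0 to i - 1 and fall from j - 1 to 0. Passing from colour c to c + 1 moves
-- one occurrence up and the other down by one, so the two positions keep their sum.
mountain : ℕ → ℕ → List ℕ
mountain i j = upTo i ++ downFrom j

length-mountain : ∀ i j → length (mountain i j) ≡ i + j
length-mountain i j = trans (length-++ (upTo i)) (cong₂ _+_ (length-upTo i) (length-downFrom j))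

moment-mountain : ∀ o i j c → moment o (δ c) (mountain i j) ≡
  moment o (δ c) (upTo i) + moment (o + i) (δ c) (downFrom j)
moment-mountain o i j c = trans (moment-++ o (δ c) (upTo i) (downFrom j))
  (cong (λ l → moment o (δ c) (upTo i) + moment (o + l) (δ c) (downFrom j)) (length-upTo i))

-- The positions are o + c and o + i + j - 1 - c; the successor avoids subtraction.
moment-mountain-pair : ∀ o {i j c} → c < i → c < j →
  suc (moment o (δ c) (mountain i j)) ≡ o + o + i + j
moment-mountain-pair o {i} {j} {c} c<i c<j
  rewrite moment-mountain o i j c | moment-upTo o c<i = begin
  suc (o + c + m)    ≡⟨ rearrange o c m ⟩
  o + (suc c + m)    ≡⟨ cong (o +_) (moment-downFrom (o + i) c<j) ⟩
  o + (o + i + j)    ≡⟨ rearrange′ o i j ⟩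
  o + o + i + j      ∎
  where
  open ≡-Reasoning
  m = moment (o + i) (δ c) (downFrom j)
  rearrange : ∀ o c m → suc (o + c + m) ≡ o + suc (c + m)
  rearrange = solve-∀
  rearrange′ : ∀ o i j → o + (o + i + j) ≡ o + o + i + j
  rearrange′ = solve-∀

-- The longer rising run puts colour `j` only at the peak, the middle of 2j + 1 consecutive
-- integers, which has no partner.
moment-mountain-top : ∀ o j → moment o (δ j) (mountain (suc j) j) ≡ o + j
moment-mountain-top o j
  rewrite moment-mountain o (suc j) j j | moment-upTo o {j} {suc j} ≤-refl
        | moment-downFrom-≥ (o + suc j) {j} {j} ≤-refl = +-identityʳ (o + j)

moment-mountain-≥ : ∀ o {i j c} → i ≤ c → j ≤ c → moment o (δ c) (mountain i j) ≡ 0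
moment-mountain-≥ o {i} {j} {c} i≤c j≤c
  rewrite moment-mountain o i j c | moment-upTo-≥ o i≤c = moment-downFrom-≥ (o + i) j≤c

-- Building balanced colourings

-- Each colour below `k` marks one subset, so disjointness is automatic; the colours from `k` on are
-- free and mark what is left out.
Balanced : ℕ → ℕ → ℕ → Set
Balanced n p k = Σ (List ℕ) λ xs → length xs ≡ n × (∀ {c} → c < k → moment 0 (δ c) xs ≡ p)

balanced-zero : ∀ n p → Balanced n p 0
balanced-zero n p = replicate n 0 , length-replicate n , λ ()

balanced-≤ : ∀ {n p k l} → k ≤ l → Balanced n p l → Balanced n p k
balanced-≤ k≤l (xs , len , eq) = xs , len , λ c<k → eq (<-≤-trans c<k k≤l)

balanced-pad : ∀ {m n p k} → m ≤ n → Balanced m p k → Balanced n p k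
balanced-pad {m} {n} {p} {k} m≤n (xs , refl , eq) = xs ++ replicate (n ∸ m) k
  , trans (length-++ xs) (trans (cong (m +_) (length-replicate (n ∸ m))) (m+[n∸m]≡n m≤n))
  , λ {c} c<k → trans (moment-++ 0 (δ c) xs _)
      (trans (cong₂ _+_ (eq c<k) (moment-replicate m (δ c) (n ∸ m) k (δ-≢ c k (<⇒≢ c<k))))
        (+-identityʳ p))

length-++-mountain : ∀ (xs : List ℕ) i j → length (xs ++ mountain i j) ≡ length xs + (i + j)
length-++-mountain xs i j = trans (length-++ xs) (cong (length xs +_) (length-mountain i j))

-- The integers n, ..., n + 2k - 1 form k pairs of sum 2n + 2k - 1, and each pair joins one subset
-- of sum `p′`.
balanced-stack : ∀ {n p p′ k} → suc p ≡ p′ + (n + n + k + k) →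
  Balanced n p′ k → Balanced (n + (k + k)) p k
balanced-stack {n} {p} {p′} {k} p-eq (xs , refl , eq) =
  xs ++ mountain k k , length-++-mountain xs k k , λ {c} c<k → suc-injective (begin
    suc (moment 0 (δ c) (xs ++ mountain k k))
      ≡⟨ cong suc (moment-++ 0 (δ c) xs _) ⟩
    suc (moment 0 (δ c) xs + moment n (δ c) (mountain k k))
      ≡⟨ sym (+-suc _ _) ⟩
    moment 0 (δ c) xs + suc (moment n (δ c) (mountain k k))
      ≡⟨ cong₂ _+_ (eq c<k) (moment-mountain-pair n c<k c<k) ⟩
    p′ + (n + n + k + k)
      ≡⟨ sym p-eq ⟩
    suc p ∎)
  where open ≡-Reasoning

-- The shift j + f x keeps the colours of xs apart from the colours c < j of
-- the pairs.
moment-shift-< : ∀ o (f : ℕ → ℕ) {j c} xs ys → c < j →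
  moment o (δ c) (map (λ x → j + f x) xs ++ ys) ≡ moment (o + length xs) (δ c) ys
moment-shift-< o f {j} {c} xs ys c<j
  rewrite moment-++ o (δ c) (map (λ x → j + f x) xs) ys
        | length-map (λ x → j + f x) xs
        | moment-map o (δ c) (λ x → j + f x) xs
        | moment-zero o {λ x → δ c (j + f x)} xs (λ x → δ-< (f x) c<j) = refl

moment-shift-≥ : ∀ o (f : ℕ → ℕ) j c xs ys →
  moment o (δ (j + c)) (map (λ x → j + f x) xs ++ ys) ≡
  moment o (λ x → δ c (f x)) xs + moment (o + length xs) (δ (j + c)) ys
moment-shift-≥ o f j c xs ys
  rewrite moment-++ o (δ (j + c)) (map (λ x → j + f x) xs) ys
        | length-map (λ x → j + f x) xs
        | moment-map o (δ (j + c)) (λ x → j + f x) xs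
        | moment-cong o {λ x → δ (j + c) (j + f x)} xs (λ x → δ-+ j c (f x)) = refl

split-colours : ∀ j {k} {P : ℕ → Set} → (∀ {c} → c < j → P c) → (∀ {c} → c < k → P (j + c)) →
  ∀ {c} → c < j + k → P c
split-colours j {k} {P} low high {c} c<j+k with c <? j
... | yes c<j = low c<j
... | no  c≮j = subst P j+[c∸j]≡c (high (+-cancelˡ-< j _ _ (subst (_< j + k) (sym j+[c∸j]≡c) c<j+k)))
  where
  j+[c∸j]≡c : j + (c ∸ j) ≡ c
  j+[c∸j]≡c = m+[n∸m]≡n (≮⇒≥ c≮j)

-- Here p = 2n + 2j - 1 is the sum of each of the `j` pairs among n, ..., n + 2j - 1, so every pair
-- is a whole subset.
balanced-odd : ∀ {n p j k} → suc p ≡ n + n + j + j →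
  Balanced n p k → Balanced (n + (j + j)) p (j + k)
balanced-odd {n} {p} {j} {k} p-eq (xs , refl , eq) =
  zs , trans (length-++-mountain (map (j +_) xs) j j) (cong (_+ (j + j)) (length-map (j +_) xs)) ,
  split-colours j low high
  where
  zs = map (j +_) xs ++ mountain j j
  low : ∀ {c} → c < j → moment 0 (δ c) zs ≡ p
  low c<j = trans (moment-shift-< 0 (λ x → x) xs _ c<j)
    (suc-injective (trans (moment-mountain-pair n c<j c<j) (sym p-eq)))
  high : ∀ {c} → c < k → moment 0 (δ (j + c)) zs ≡ p
  high {c} c<k = trans (moment-shift-≥ 0 (λ x → x) j c xs _)
    (trans (cong₂ _+_ (eq c<k) (moment-mountain-≥ n (m≤m+n j c) (m≤m+n j c))) (+-identityʳ p))

-- Colour 0 of the given colouring joins the middle element n + j, and the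
-- colours 2t + 1 and 2t + 2 are merged.
balanced-even : ∀ {n j k l} → k + k ≤ suc l →
  Balanced n (n + j) l → Balanced (n + suc (j + j)) ((n + j) + (n + j)) (j + k)
balanced-even {n} {j} {k} {l} 2k≤1+l (xs , refl , eq) =
  zs ,
  trans (length-++-mountain (map f xs) (suc j) j) (cong (_+ suc (j + j)) (length-map f xs)) ,
  split-colours j low high
  where
  open ≡-Reasoning
  f : ℕ → ℕ
  f x = j + ⌈ x /2⌉
  zs = map f xs ++ mountain (suc j) j
  low : ∀ {c} → c < j → moment 0 (δ c) zs ≡ (n + j) + (n + j)
  low c<j = trans (moment-shift-< 0 ⌈_/2⌉ xs _ c<j)
    (suc-injective (trans (moment-mountain-pair n (m<n⇒m<1+n c<j) c<j) (rearrange n j)))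
    where
    rearrange : ∀ n j → n + n + suc j + j ≡ suc ((n + j) + (n + j))
    rearrange = solve-∀
  high : ∀ {c} → c < k → moment 0 (δ (j + c)) zs ≡ (n + j) + (n + j)
  high {zero} 0<k = begin
    moment 0 (δ (j + 0)) zs
      ≡⟨ moment-shift-≥ 0 ⌈_/2⌉ j 0 xs _ ⟩
    moment 0 (λ x → δ 0 ⌈ x /2⌉) xs + moment n (δ (j + 0)) (mountain (suc j) j)
      ≡⟨ cong₂ _+_ (moment-cong 0 xs δ-zero-⌈/2⌉)
           (cong (λ c → moment n (δ c) (mountain (suc j) j)) (+-identityʳ j)) ⟩
    moment 0 (δ 0) xs + moment n (δ j) (mountain (suc j) j)
      ≡⟨ cong₂ _+_ (eq (≤-pred (≤-trans (+-mono-≤ 0<k 0<k) 2k≤1+l))) (moment-mountain-top n j) ⟩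
    (n + j) + (n + j) ∎
  high {suc t} t<k = begin
    moment 0 (δ (j + suc t)) zs
      ≡⟨ moment-shift-≥ 0 ⌈_/2⌉ j (suc t) xs _ ⟩
    moment 0 (λ x → δ (suc t) ⌈ x /2⌉) xs + moment n (δ (j + suc t)) (mountain (suc j) j)
      ≡⟨ cong₂ _+_ (moment-cong 0 xs (δ-suc-⌈/2⌉ t))
           (moment-mountain-≥ n (m<m+n j (s≤s z≤n)) (m≤m+n j (suc t))) ⟩
    moment 0 (λ x → δ (1 + (t + t)) x + δ (2 + (t + t)) x) xs + 0
      ≡⟨ +-identityʳ _ ⟩
    moment 0 (λ x → δ (1 + (t + t)) x + δ (2 + (t + t)) x) xs
      ≡⟨ moment-+ 0 (δ (1 + (t + t))) (δ (2 + (t + t))) xs ⟩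
    moment 0 (δ (1 + (t + t))) xs + moment 0 (δ (2 + (t + t))) xs
      ≡⟨ cong₂ _+_ (eq (<-trans ≤-refl 2+2t<l)) (eq 2+2t<l) ⟩
    (n + j) + (n + j) ∎
    where
    2+2t<l : 2 + (t + t) < l
    2+2t<l = ≤-pred (≤-trans (≤-reflexive (rearrange t)) (≤-trans (+-mono-≤ t<k t<k) 2k≤1+l))
      where
      rearrange : ∀ t → suc (suc (2 + (t + t))) ≡ suc (suc t) + suc (suc t)
      rearrange = solve-∀

-- The inequality on the total and its descent

-- k p ≤ n (n − 1) / 2, without subtraction and division.
Budget : ℕ → ℕ → ℕ → Set
Budget n p k = 2 * (k * p) + n ≤ n * n

budget-zero : ∀ n p → Budget n p 0
budget-zero zero    p = z≤n
budget-zero (suc n) p = m≤m+n (suc n) (n * suc n)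

-- The `j` pairs of sum 2n + 2j - 1 use up exactly the removed integers, so both sides drop by `r`:
-- twice the sum of these integers plus their number.
budget-odd : ∀ n i k → let j = suc i in
  Budget (n + (j + j)) (n + n + i + j) (j + k) → Budget n (n + n + i + j) k
budget-odd n i k b = +-cancelʳ-≤ (r n i) _ _ (subst₂ _≤_ (lhs n i k) (rhs n i) b)
  where
  r : ℕ → ℕ → ℕ
  r n i = 2 * (suc i * (n + n + i + suc i)) + (suc i + suc i)
  lhs : ∀ n i k → 2 * ((suc i + k) * (n + n + i + suc i)) + (n + (suc i + suc i)) ≡
    2 * (k * (n + n + i + suc i)) + n + (2 * (suc i * (n + n + i + suc i)) + (suc i + suc i))
  lhs = solve-∀
  rhs : ∀ n i → (n + (suc i + suc i)) * (n + (suc i + suc i)) ≡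
    n * n + (2 * (suc i * (n + n + i + suc i)) + (suc i + suc i))
  rhs = solve-∀

-- The removed integers n, ..., n + 2j sum to (2j + 1)(n + j). Out of 2(j + t + 1) multiples of n +
-- j this leaves 2t + 1, the number of half-size subsets needed.
budget-even : ∀ n j t →
  Budget (n + suc (j + j)) ((n + j) + (n + j)) (j + suc t) → Budget n (n + j) (t + suc t)
budget-even n j t b = +-cancelʳ-≤ (r n j) _ _ (subst₂ _≤_ (lhs n j t) (rhs n j) b)
  where
  r : ℕ → ℕ → ℕ
  r n j = suc (j + j) * ((n + j) + (n + j)) + suc (j + j)
  lhs : ∀ n j t → 2 * ((j + suc t) * ((n + j) + (n + j))) + (n + suc (j + j)) ≡
    2 * ((t + suc t) * (n + j)) + n + (suc (j + j) * ((n + j) + (n + j)) + suc (j + j))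
  lhs = solve-∀
  rhs : ∀ n j → (n + suc (j + j)) * (n + suc (j + j)) ≡
    n * n + (suc (j + j) * ((n + j) + (n + j)) + suc (j + j))
  rhs = solve-∀

budget-stack : ∀ n p′ k₀ → let k = suc k₀ in
  Budget (n + (k + k)) (p′ + (n + n + k₀ + k)) k → Budget n p′ k
budget-stack n p′ k₀ b = +-cancelʳ-≤ (r n k₀) _ _ (subst₂ _≤_ (lhs n p′ k₀) (rhs n k₀) b)
  where
  r : ℕ → ℕ → ℕ
  r n k₀ = 2 * (suc k₀ * (n + n + k₀ + suc k₀)) + (suc k₀ + suc k₀)
  lhs : ∀ n p′ k₀ → 2 * (suc k₀ * (p′ + (n + n + k₀ + suc k₀))) + (n + (suc k₀ + suc k₀)) ≡
    2 * (suc k₀ * p′) + n + (2 * (suc k₀ * (n + n + k₀ + suc k₀)) + (suc k₀ + suc k₀))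
  lhs = solve-∀
  rhs : ∀ n k₀ → (n + (suc k₀ + suc k₀)) * (n + (suc k₀ + suc k₀)) ≡
    n * n + (2 * (suc k₀ * (n + n + k₀ + suc k₀)) + (suc k₀ + suc k₀))
  rhs = solve-∀

-- The integers 0, ..., p sum to p(p + 1)/2, enough for (p + 1)/2 subsets. This serves when stacking
-- leaves more small integers than the condition n ≤ p + 1 admits.
budget-truncated : ∀ p k → k + k ≤ suc p → Budget (suc p) p k
budget-truncated p k 2k≤1+p = begin
  2 * (k * p) + suc p      ≡⟨ lhs p k ⟩
  (k + k) * p + suc p      ≤⟨ +-monoˡ-≤ (suc p) (*-monoˡ-≤ p 2k≤1+p) ⟩
  suc p * p + suc p        ≡⟨ rhs p ⟩
  suc p * suc p            ∎
  where
  open ≤-Reasoning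
  lhs : ∀ p k → 2 * (k * p) + suc p ≡ (k + k) * p + suc p
  lhs = solve-∀
  rhs : ∀ p → suc p * p + suc p ≡ suc p * suc p
  rhs = solve-∀

-- This makes the 2k largest integers available. With n = m + 1 and p = 2n - 1 + d, having 2k ≥ n +
-- 1 would force 2kp + n ≥ (n + 1)(2n - 1) + n > n².
budget⇒2k≤n : ∀ m d k → Budget (suc m) (m + suc m + d) k → k + k ≤ suc m
budget⇒2k≤n m d k b = ≮⇒≥ λ 1+m<2k → <⇒≱ (begin-strict
  suc m * suc m                              <⟨ m<m+n (suc m * suc m) (s≤s z≤n) ⟩
  suc m * suc m + suc (m * m + 4 * m + 1 + (2 + m) * d)
                                             ≡⟨ expand m d ⟩
  (2 + m) * (m + suc m + d) + suc m          ≤⟨ +-monoˡ-≤ (suc m) (*-monoˡ-≤ (m + suc m + d) 1+m<2k) ⟩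
  (k + k) * (m + suc m + d) + suc m          ≡⟨ double k (m + suc m + d) (suc m) ⟩
  2 * (k * (m + suc m + d)) + suc m          ∎) b
  where
  open ≤-Reasoning
  expand : ∀ m d → suc m * suc m + suc (m * m + 4 * m + 1 + (2 + m) * d) ≡
    (2 + m) * (m + suc m + d) + suc m
  expand = solve-∀
  double : ∀ k p n → (k + k) * p + n ≡ 2 * (k * p) + n
  double = solve-∀

-- Induction on the number of integers

half : ∀ n → (∃ λ j → n ≡ j + j) ⊎ (∃ λ j → n ≡ suc (j + j))
half zero = inj₁ (0 , refl)
half (suc n) with half n
... | inj₁ (j , refl) = inj₂ (j , refl)
... | inj₂ (j , refl) = inj₁ (suc j , cong suc (sym (+-suc j j)))

Hypothesis : ℕ → Set
Hypothesis n = ∀ p k → n ≤ suc p → Budget n p k → Balanced n p k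

pair-sum-odd : ∀ n i → n + (suc i + suc i) + n ≡ suc (n + n + i + suc i)
pair-sum-odd = solve-∀

pair-sum-even : ∀ n j → n + suc (j + j) + n ≡ suc ((n + j) + (n + j))
pair-sum-even = solve-∀

stack-sum : ∀ n d k₀ → n + (suc k₀ + suc k₀) + (n + (suc k₀ + suc k₀) + d) ≡
  suc (suc k₀ + suc k₀ + d + (n + n + k₀ + suc k₀))
stack-sum = solve-∀

-- Since p = 2n + s - 1, the integers n, ..., n + s - 1 are symmetric about p/2, and `p` is even
-- exactly when `s` is odd, that is, when p/2 is one of them.
pairing : ∀ n s {p} k → 0 < s → n + s + n ≡ suc p →
  Hypothesis n → Budget (n + s) p k → Balanced (n + s) p k
pairing n s k 0<s p-eq ih b with half s
pairing n _ k 0<s p-eq ih b | inj₁ (suc i , refl)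
  with refl ← suc-injective (trans (sym p-eq) (pair-sum-odd n i)) =
  -- If k is below the number of pairs, `∸` asks for no further subsets and the surplus pairs are
  -- dropped.
  balanced-≤ (m≤n+m∸n k (suc i)) (balanced-odd (rearrange n i) (ih p (k ∸ suc i) n≤1+p b′))
  where
  p = n + n + i + suc i
  rearrange : ∀ n i → suc (n + n + i + suc i) ≡ n + n + suc i + suc i
  rearrange = solve-∀
  n≤1+p : n ≤ suc p
  n≤1+p = subst (n ≤_) p-eq (m≤n+m n _)
  b′ : Budget n p (k ∸ suc i)
  b′ with ≤-total k (suc i)
  ... | inj₁ k≤j rewrite m≤n⇒m∸n≡0 k≤j = budget-zero n p
  ... | inj₂ j≤k = budget-odd n i (k ∸ suc i)
    (subst (Budget (n + (suc i + suc i)) p) (sym (m+[n∸m]≡n j≤k)) b)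
pairing n _ k 0<s p-eq ih b | inj₂ (j , refl)
  with refl ← suc-injective (trans (sym p-eq) (pair-sum-even n j)) =
  balanced-≤ (m≤n+m∸n k j)
    (balanced-even {k = k ∸ j} (m≤n+m∸n _ 1)
      (ih (n + j) _ (m≤n⇒m≤1+n (m≤m+n n j)) (b′ (k ∸ j) refl)))
  where
  -- To finish l subsets of sum p, only 2l - 1 of sum p/2 are needed, as the middle element p/2
  -- stands in for one; truncation gives none for l = 0.
  b′ : ∀ l → k ∸ j ≡ l → Budget n (n + j) (l + l ∸ 1)
  b′ zero    _  = budget-zero n (n + j)
  b′ (suc t) eq = budget-even n j t (subst (Budget (n + suc (j + j)) ((n + j) + (n + j)))
    (sym (trans (cong (j +_) (sym eq)) (m+[n∸m]≡n j≤k))) b)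
    where
    j≤k : j ≤ k
    j≤k = <⇒≤ (m∸n≢0⇒n<m λ k∸j≡0 → 1+n≢0 (trans (sym eq) k∸j≡0))

stacking : ∀ n d {p} k₀ → let k = suc k₀ in n + (n + d) ≡ suc p →
  (∀ {m} → m < n → Hypothesis m) → Budget n p k → Balanced n p k
stacking zero d {p} k₀ p-eq ih b = [] , refl , λ _ → sym p≡0
  where
  p≡0 : p ≡ 0
  p≡0 = m+n≡0⇒m≡0 p (m+n≡0⇒m≡0 (p + k₀ * p) (m+n≡0⇒m≡0 (2 * (suc k₀ * p)) (n≤0⇒n≡0 b)))
stacking (suc m) d k₀ p-eq ih b
  with refl ← suc-injective (trans (sym p-eq) (cong suc (sym (+-assoc m (suc m) d))))
  = from-top (suc m ∸ (k + k)) (m∸n+n≡m (budget⇒2k≤n m d k b)) p-eq ih b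
  where
  k  = suc k₀
  -- With N = n + 2k and p = 2N - 1 + d, removing a pair of sum 2n + 2k - 1 leaves this.
  p′ = k + k + d
  rearrange : ∀ n d k₀ → suc (suc k₀ + suc k₀ + d + (n + n + k₀ + suc k₀)) ≡
    suc k₀ + suc k₀ + d + (n + n + suc k₀ + suc k₀)
  rearrange = solve-∀
  from-top : ∀ n {N p} → n + (k + k) ≡ N → N + (N + d) ≡ suc p →
    (∀ {m} → m < N → Hypothesis m) → Budget N p k → Balanced N p k
  from-top n refl p-eq ih b with refl ← suc-injective (trans (sym p-eq) (stack-sum n d k₀)) =
    balanced-stack (rearrange n d k₀) filled
    where
    n<n+2k : n < n + (k + k)
    n<n+2k = m<m+n n (s≤s z≤n)
    filled : Balanced n p′ k
    filled with n ≤? suc p′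
    ... | yes n≤1+p′ = ih n<n+2k p′ k n≤1+p′ (budget-stack n p′ k₀ b)
    -- Here n > p′ + 1, so only 0, ..., p′ are used and the other integers stay free; these suffice
    -- because p′ ≥ 2k.
    ... | no  n≰1+p′ = balanced-pad (<⇒≤ (≰⇒> n≰1+p′))
      (ih (<-trans (≰⇒> n≰1+p′) n<n+2k) p′ k ≤-refl
        (budget-truncated p′ k (m≤n⇒m≤1+n (m≤m+n (k + k) d))))

balanced : ∀ {n} → Acc _<_ n → Hypothesis n
-- Stacking removes 2k integers and would not descend for k = 0.
balanced {n} _        p zero      n≤1+p b = balanced-zero n p
balanced {n} (acc rs) p (suc k₀) n≤1+p b with suc p ∸ n <? n | m+[n∸m]≡n n≤1+p
... | yes n′<n | p-eq = subst (λ m → Balanced m p (suc k₀)) n′+s≡n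
  (pairing n′ (n ∸ n′) (suc k₀) (m<n⇒0<n∸m n′<n) (trans (cong (_+ n′) n′+s≡n) p-eq) (balanced (rs n′<n))
    (subst (λ m → Budget m p (suc k₀)) (sym n′+s≡n) b))
  where
  n′ = suc p ∸ n
  n′+s≡n : n′ + (n ∸ n′) ≡ n
  n′+s≡n = m+[n∸m]≡n (<⇒≤ n′<n)
... | no  n′≮n | p-eq = stacking n (suc p ∸ n ∸ n) k₀
  (trans (cong (n +_) (m+[n∸m]≡n (≮⇒≥ n′≮n))) p-eq) (λ m<n → balanced (rs m<n)) b

-- From subsets of integers to edge colourings

2*nC2+n≡n*n : ∀ n → 2 * (n C 2) + n ≡ n * n
2*nC2+n≡n*n zero    = refl
2*nC2+n≡n*n (suc n) = begin
  2 * (suc n C 2) + suc n        ≡⟨ cong (λ t → 2 * t + suc n) (sym (nCk+nC[k+1]≡[n+1]C[k+1] n 1)) ⟩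
  2 * (n C 1 + n C 2) + suc n    ≡⟨ cong (λ t → 2 * (t + n C 2) + suc n) (nC1≡n n) ⟩
  2 * (n + n C 2) + suc n        ≡⟨ rearrange n (n C 2) ⟩
  2 * (n C 2) + n + suc (n + n)  ≡⟨ cong (_+ suc (n + n)) (2*nC2+n≡n*n n) ⟩
  n * n + suc (n + n)            ≡⟨ rearrange′ n ⟩
  suc n * suc n                  ∎
  where
  open ≡-Reasoning
  rearrange : ∀ n t → 2 * (n + t) + suc n ≡ 2 * t + n + suc (n + n)
  rearrange = solve-∀
  rearrange′ : ∀ n → n * n + suc (n + n) ≡ suc n * suc n
  rearrange′ = solve-∀

nC2⇒budget : ∀ n p k {q} → n C 2 ≡ k * p + q → Budget n p k
nC2⇒budget n p k {q} eq = subst (2 * (k * p) + n ≤_) (2*nC2+n≡n*n n)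
  (+-monoˡ-≤ n (*-monoʳ-≤ 2 (subst (k * p ≤_) (sym eq) (m≤m+n (k * p) q))))

Fin-cong : ∀ {m n} → m ≡ n → Fin m ↔ Fin n
Fin-cong refl = mk↔ₛ′ (λ i → i) (λ i → i) (λ _ → refl) (λ _ → refl)

Σ-suc : ∀ {n} {B : Fin (suc n) → Set} → Σ (Fin (suc n)) B ↔ (B zero ⊎ Σ (Fin n) (B ∘ suc))
Σ-suc = mk↔ₛ′
  (λ { (zero , b) → inj₁ b ; (suc i , b) → inj₂ (i , b) })
  (λ { (inj₁ b) → zero , b ; (inj₂ (i , b)) → suc i , b })
  (λ { (inj₁ _) → refl ; (inj₂ _) → refl })
  (λ { (zero , _) → refl ; (suc _ , _) → refl })

-- The weight `w` is kept abstract so that the induction can pass to the tail with the offset raised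
-- by one.
moment-counts : ∀ {A : Set} {P : A → Set} {g : A → ℕ} → (∀ x w → (P x × Fin w) ↔ Fin (g x * w)) →
  ∀ o xs (w : Fin (length xs) → ℕ) → (∀ v → w v ≡ o + toℕ v) →
  Σ (Fin (length xs)) (λ v → P (lookup xs v) × Fin (w v)) ↔ Fin (moment o g xs)
moment-counts indicates o []       w w-eq =
  mk↔ₛ′ (λ ()) (λ ()) (λ ()) (λ ())
moment-counts {g = g} indicates o (x ∷ xs) w w-eq =
  (↔-sym +↔⊎ ↔-∘
  ((Fin-cong (cong (g x *_) (trans (w-eq zero) (+-identityʳ o))) ↔-∘ indicates x (w zero))
    ⊎-↔ moment-counts indicates (suc o) xs (w ∘ suc) (λ v → trans (w-eq (suc v)) (+-suc o (toℕ v)))))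
  ↔-∘ Σ-suc

δ-indicates : ∀ {m} (c i : Fin m) w → (i ≡ c × Fin w) ↔ Fin (δ (toℕ c) (toℕ i) * w)
δ-indicates c i w with i ≟F c
... | yes refl rewrite δ-refl (toℕ i) | +-identityʳ w =
  mk↔ₛ′ proj₂ (refl ,_) (λ _ → refl) (λ { (refl , _) → refl })
... | no  i≢c rewrite δ-≢ (toℕ c) (toℕ i) (i≢c ∘ sym ∘ toℕ-injective) =
  mk↔ₛ′ (λ { (i≡c , _) → ⊥-elim (i≢c i≡c) }) (λ ()) (λ ()) (λ { (i≡c , _) → ⊥-elim (i≢c i≡c) })

colorClass-by-hi : ∀ {n m} (κ : Fin n → Fin m) c →
  ColorClass (κ ∘ Edge.hi) c ↔ Σ (Fin n) (λ v → κ v ≡ c × Fin (toℕ v))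
colorClass-by-hi {n} κ c = mk↔ₛ′ to from
  (λ { (v , eq , i) → cong (λ i → v , eq , i) (toℕ-injective
    (trans (toℕ-fromℕ< (inject< i)) (toℕ-inject i))) })
  (λ { (edge u v u<v , eq) → edge-cong eq (toℕ-injective
    (trans (toℕ-inject (fromℕ< u<v)) (toℕ-fromℕ< u<v))) })
  where
  inject< : ∀ {v : Fin n} (i : Fin (toℕ v)) → toℕ (inject {i = v} i) < toℕ v
  inject< {v} i = subst (_< toℕ v) (sym (toℕ-inject i)) (toℕ<n i)
  to : ColorClass (κ ∘ Edge.hi) c → Σ (Fin n) (λ v → κ v ≡ c × Fin (toℕ v))
  to (edge u v u<v , eq) = v , eq , fromℕ< u<v
  from : Σ (Fin n) (λ v → κ v ≡ c × Fin (toℕ v)) → ColorClass (κ ∘ Edge.hi) c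
  from (v , eq , i) = edge (inject i) v (inject< i) , eq
  edge-cong : ∀ {u u′ v} .{u<v : toℕ u < toℕ v} .{u′<v : toℕ u′ < toℕ v} (eq : κ v ≡ c) → u ≡ u′ →
    _≡_ {A = ColorClass (κ ∘ Edge.hi) c} (edge u v u<v , eq) (edge u′ v u′<v , eq)
  edge-cong eq refl = refl

-- All free colours are lumped into colour `k`, the remaining class.
truncate : ∀ k → ℕ → Fin (suc k)
truncate k x = fromℕ< (s≤s (m⊓n≤n x k))

theorem4 : ∀ (n p k q : ℕ) → n ≥ 1 → p ≥ n ∸ 1 → n C 2 ≡ k * p + q →
    Σ (EdgeColoring n (suc k)) λ χ → IsGallai χ ×
    (Σ (Fin (suc k)) λ r →
    HasExactly (ColorClass χ r) q ×
    (∀ (c : Fin (suc k)) → c ≢ r → HasExactly (ColorClass χ c) p))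
theorem4 n p k q n≥1 p≥n-1 nC2≡kp+q
  with xs , refl , eq ← balanced (<-wellFounded n) p k (≤-trans (m≤n+m∸n n 1) (s≤s p≥n-1))
      (nC2⇒budget n p k nC2≡kp+q) =
  -- In a triangle u < v < w the edges vw and uw share the larger endpoint w, so their colours agree
  -- by `refl`.
  κ ∘ Edge.hi , (λ { _ _ _ _ _ (_ , vw≢uw , _) → vw≢uw refl }) , fromℕ k ,
  Fin-cong rest ↔-∘ class (fromℕ k) ,
  λ c c≢k → Fin-cong (regular c (c<k c c≢k)) ↔-∘ class c
  where
  open ≡-Reasoning
  κ : Fin (length xs) → Fin (suc k)
  κ v = truncate k (lookup xs v)
  size : Fin (suc k) → ℕ
  size c = moment 0 (λ x → δ (toℕ c) (toℕ (truncate k x))) xs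
  class : ∀ c → ColorClass (κ ∘ Edge.hi) c ↔ Fin (size c)
  class c = moment-counts (λ x → δ-indicates c (truncate k x)) 0 xs toℕ (λ _ → refl)
    ↔-∘ colorClass-by-hi κ c
  size-⊓ : ∀ c → size c ≡ moment 0 (λ x → δ (toℕ c) (x ⊓ k)) xs
  size-⊓ c = moment-cong 0 xs λ x → cong (δ (toℕ c)) (toℕ-fromℕ< (s≤s (m⊓n≤n x k)))
  c<k : ∀ c → c ≢ fromℕ k → toℕ c < k
  c<k c c≢k = ≤∧≢⇒< (≤-pred (toℕ<n c)) λ c≡k → c≢k (toℕ-injective (trans c≡k (sym (toℕ-fromℕ k))))
  regular : ∀ c → toℕ c < k → size c ≡ p
  regular c c<k = trans (size-⊓ c) (trans (moment-cong 0 xs (λ x → δ-⊓ x c<k)) (eq c<k))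
  rest : size (fromℕ k) ≡ q
  rest = +-cancelˡ-≡ (k * p) _ _ (begin
    k * p + size (fromℕ k)
      ≡⟨ cong (k * p +_) (size-⊓ (fromℕ k)) ⟩
    k * p + moment 0 (λ x → δ (toℕ (fromℕ k)) (x ⊓ k)) xs
      ≡⟨ cong (λ c → k * p + moment 0 (λ x → δ c (x ⊓ k)) xs) (toℕ-fromℕ k) ⟩
    k * p + moment 0 (λ x → δ k (x ⊓ k)) xs
      ≡⟨ moment-δ-⊓ 0 k xs eq ⟩
    moment 0 (λ _ → 1) xs
      ≡⟨ moment-const-1 0 xs ⟩
    length xs * 0 + length xs C 2
      ≡⟨ cong (_+ length xs C 2) (*-zeroʳ (length xs)) ⟩
    length xs C 2
      ≡⟨ nC2≡kp+q ⟩
    k * p + q ∎)
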